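{- Let $G=(V,E)$ be a finite simple undirected graph of order $n\ge 1$ and maximum degree $\Delta$. Then $\kappa(G)=\frac{n\Delta}{\Delta+1}$ if and only if $G$ has a perfect code $C$ such that every $v\in C$ has degree $d(v)=\Delta$.
   Context: For a graph $G=(V,E)$ and $C\subseteq V$, let $Odd(C)=\{v\in V : |N(v)\cap C|\equiv 1 \pmod 2\}$, where $N(v)$ is the open neighborhood of $v$. A set $B\subseteq V$ is a weak odd dominated (WOD) set if there exists $C\subseteq V\setminus B$ with $B\subseteq Odd(C)$. $\kappa(G)$ is the maximum size of a WOD set of $G$. A perfect code of $G$ is a set $C\subseteq V$ such that $C$ is an independent set and every vertex in $V\setminus C$ has exactly one neighbor in $C$. -}

module Defs where

open import Data.Fin.Base using (Fin)
open import Data.Fin.Subset using (Subset; _∈_; _∉_; _⊆_; _∩_; ∁; ∣_∣; ⊥)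
open import Data.Fin.Subset.Properties using (_⊆?_; anySubset?; ∣p∣≤n; ∉⊥)
open import Data.List.Base using (map; allFin; upTo; filter)
open import Data.List.Extrema.Nat using (max; argmax-sel; xs≤max)
open import Data.List.Membership.Propositional.Properties
  using (∈-allFin; ∈-map⁺; ∈-map⁻; ∈-upTo⁺; ∈-filter⁺; ∈-filter⁻)
import Data.List.Relation.Unary.All as All
open import Data.Nat.Base using (ℕ; suc; _≤_; s≤s; z≤n; _%_)
open import Data.Nat.Properties using (_≟_; ≤-antisym)
open import Data.Product.Base using (_×_; _,_; ∃; proj₂)
open import Data.Sum.Base using (inj₁; inj₂)
open import Data.Vec.Base using (tabulate)
open import Data.Vec.Properties using (lookup∘tabulate; []=⇒lookup; lookup⇒[]=)
open import Data.Empty using (⊥-elim)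
open import Function.Base using (_∘_; id)
open import Level using (Level)
open import Relation.Binary.Core using (Rel)
import Relation.Binary.Definitions as B
open import Relation.Binary.PropositionalEquality
  using (_≡_; refl; sym; trans; subst)
open import Relation.Nullary using (¬_; does; proof; Reflects; invert)
open import Relation.Nullary.Decidable using (_×-dec_; dec-true)
open import Relation.Unary using (Pred; Decidable)

private
  variable
    n : ℕ
    ℓ : Level

⟦_⟧ : {P : Pred (Fin n) ℓ} → Decidable P → Subset n
⟦ P? ⟧ = tabulate (does ∘ P?)

∈⟦⟧⁺ : {P : Pred (Fin n) ℓ} (P? : Decidable P) {v : Fin n} → P v → v ∈ ⟦ P? ⟧
∈⟦⟧⁺ P? {v} p =
  lookup⇒[]= v ⟦ P? ⟧ (trans (lookup∘tabulate _ v) (dec-true (P? v) p))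

∈⟦⟧⁻ : {P : Pred (Fin n) ℓ} (P? : Decidable P) {v : Fin n} → v ∈ ⟦ P? ⟧ → P v
∈⟦⟧⁻ {P = P} P? {v} v∈ = invert (subst (Reflects (P v))
  (trans (sym (lookup∘tabulate _ v)) ([]=⇒lookup v∈)) (proof (P? v)))

record Graph (n : ℕ) : Set₁ where
  infix 4 _~_ _~?_
  field
    _~_   : Rel (Fin n) Level.zero
    _~?_  : B.Decidable _~_
    ~-sym : B.Symmetric _~_
    ~-irr : B.Irreflexive _≡_ _~_

module _ (G : Graph n) where
  open Graph G

  N : Fin n → Subset n
  N v = ⟦ v ~?_ ⟧

  degree : Fin n → ℕ
  degree v = ∣ N v ∣

  -- The default value 0 matters only for n = 0: see Δ-attained.
  Δ : ℕ
  Δ = max 0 (map degree (allFin n))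

  Odd : Subset n → Subset n
  Odd C = ⟦ (λ v → ∣ N v ∩ C ∣ % 2 ≟ 1) ⟧

  WOD : Subset n → Set
  WOD B = ∃ λ C → C ⊆ ∁ B × B ⊆ Odd C

  WOD? : Decidable WOD
  WOD? B = anySubset? λ C → (C ⊆? ∁ B) ×-dec (B ⊆? Odd C)

  HasWODOfSize : ℕ → Set
  HasWODOfSize k = ∃ λ B → WOD B × ∣ B ∣ ≡ k

  hasWODOfSize? : Decidable HasWODOfSize
  hasWODOfSize? k = anySubset? λ B → WOD? B ×-dec (∣ B ∣ ≟ k)

  -- Subsets have at most n elements, so this ranges over all sizes of WOD
  -- sets; the empty set is WOD, so the default value 0 is harmless.
  κ : ℕ
  κ = max 0 (filter hasWODOfSize? (upTo (suc n)))

  Independent : Subset n → Set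
  Independent C = ∀ {u v} → u ∈ C → v ∈ C → ¬ u ~ v

  PerfectCode : Subset n → Set
  PerfectCode C = Independent C × (∀ {v} → v ∉ C → ∣ N v ∩ C ∣ ≡ 1)

  degree≤Δ : ∀ v → degree v ≤ Δ
  degree≤Δ v = All.lookup (xs≤max 0 _) (∈-map⁺ degree (∈-allFin v))

  WOD⇒≤κ : ∀ {B} → WOD B → ∣ B ∣ ≤ κ
  WOD⇒≤κ {B} w = All.lookup (xs≤max 0 _)
    (∈-filter⁺ hasWODOfSize? (∈-upTo⁺ (s≤s (∣p∣≤n B))) (B , w , refl))

  κ-attained : HasWODOfSize κ
  κ-attained with argmax-sel id 0 (filter hasWODOfSize? (upTo (suc n)))
  ... | inj₂ κ∈  = proj₂ (∈-filter⁻ hasWODOfSize? {xs = upTo (suc n)} κ∈)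
  ... | inj₁ κ≡0 = ⊥ , ⊥-WOD ,
    ≤-antisym (WOD⇒≤κ ⊥-WOD) (subst (_≤ ∣ ⊥ {n} ∣) (sym κ≡0) z≤n)
    where
    ⊥-WOD : WOD ⊥
    ⊥-WOD = ⊥ , (λ x∈ → ⊥-elim (∉⊥ x∈)) , (λ x∈ → ⊥-elim (∉⊥ x∈))

Δ-attained : (G : Graph (suc n)) → ∃ λ v → degree G v ≡ Δ G
Δ-attained {n} G with argmax-sel id 0 (map (degree G) (allFin (suc n)))
... | inj₁ Δ≡0 = Fin.zero , ≤-antisym (degree≤Δ G Fin.zero)
  (subst (_≤ degree G Fin.zero) (sym Δ≡0) z≤n)
... | inj₂ Δ∈  with ∈-map⁻ (degree G) Δ∈
...   | v , _ , eq = v , sym eq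

{-# OPTIONS --safe #-}
-- For B dominated by C ⊆ ∁ B, double counting the edges between B and ∁ B gives
--   ∣B∣ ≤ Σ[v ∈ B] ∣N v ∩ ∁ B∣ = Σ[c ∈ ∁ B] ∣N c ∩ B∣ ≤ ∣∁ B∣ Δ,
-- that is, ∣B∣ (Δ + 1) ≤ n Δ. Equality forces each v ∈ B to have exactly one
-- neighbour in ∁ B, and each c ∈ ∁ B to have Δ neighbours, all in B, so ∁ B is a
-- perfect code. Conversely the complement of a perfect code of vertices of
-- degree Δ is a WOD set for which these inequalities are equalities.
module Submission where

open import Defs
open import Data.Bool.Base using (if_then_else_)
open import Data.Fin.Base using (Fin; zero; suc)
open import Data.Fin.Subset
  using (Subset; inside; outside; _∈_; _⊆_; _∩_; ∁; ∣_∣)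
open import Data.Fin.Subset.Properties
open import Data.Integer.Properties using (+-injective; pos-*)
open import Data.Nat.Base
  using (ℕ; suc; _+_; _*_; _≤_; _≥_; _%_; z≤n; s≤s)
open import Data.Nat.Properties
open import Data.Product.Base using (_×_; _,_; ∃; proj₂)
open import Data.Rational.Base using (_/_)
open import Data.Rational.Properties using (fromℚᵘ-cong; fromℚᵘ-injective)
open import Data.Rational.Unnormalised.Base using (mkℚᵘ; *≡*)
open import Data.Vec.Base using ([]; _∷_; lookup; here; there)
open import Data.Vec.Properties using (lookup∘tabulate)
open import Function.Base using (_∘_)
open import Function.Bundles using (_⇔_; mk⇔)
open import Relation.Binary.PropositionalEquality
open import Relation.Nullary using (does; yes; no; contradiction)
open import Relation.Nullary.Decidable using (does-⇔)

private
  variable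
    n m : ℕ

-- Recursion on the subset itself keeps `here` and `there` in step with the sum, so summands need to
-- be controlled only at members.
sumOver : Subset n → (Fin n → ℕ) → ℕ
sumOver []            f = 0
sumOver (inside ∷ p)  f = f zero + sumOver p (f ∘ suc)
sumOver (outside ∷ p) f = sumOver p (f ∘ suc)

sumOver-const : (p : Subset n) (k : ℕ) → sumOver p (λ _ → k) ≡ ∣ p ∣ * k
sumOver-const []            k = refl
sumOver-const (inside ∷ p)  k = cong (k +_) (sumOver-const p k)
sumOver-const (outside ∷ p) k = sumOver-const p k

sumOver-cong : (p : Subset n) {f g : Fin n → ℕ} →
  (∀ {v} → v ∈ p → f v ≡ g v) → sumOver p f ≡ sumOver p g
sumOver-cong []            f≡g = refl
sumOver-cong (inside ∷ p)  f≡g = cong₂ _+_ (f≡g here) (sumOver-cong p (f≡g ∘ there))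
sumOver-cong (outside ∷ p) f≡g = sumOver-cong p (f≡g ∘ there)

sumOver-mono : (p : Subset n) {f g : Fin n → ℕ} →
  (∀ {v} → v ∈ p → f v ≤ g v) → sumOver p f ≤ sumOver p g
sumOver-mono []            f≤g = z≤n
sumOver-mono (inside ∷ p)  f≤g = +-mono-≤ (f≤g here) (sumOver-mono p (f≤g ∘ there))
sumOver-mono (outside ∷ p) f≤g = sumOver-mono p (f≤g ∘ there)

-- Slack in one summand cannot be made up by the other: replace one by its upper bound, then cancel
-- it.
+-tight : ∀ {a b c d} → a ≤ c → b ≤ d → c + d ≤ a + b → c ≤ a × d ≤ b
+-tight {a} {b} {c} {d} a≤c b≤d c+d≤a+b =
  +-cancelʳ-≤ d c a (≤-trans c+d≤a+b (+-monoʳ-≤ a b≤d)) ,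
  +-cancelˡ-≤ c d b (≤-trans c+d≤a+b (+-monoˡ-≤ b a≤c))

-- The equality case of `sumOver-mono`, which turns an equality of totals into information about
-- each single vertex.
sumOver-tight : (p : Subset n) {f g : Fin n → ℕ} →
  (∀ {v} → v ∈ p → f v ≤ g v) → sumOver p g ≤ sumOver p f →
  ∀ {v} → v ∈ p → f v ≡ g v
sumOver-tight (outside ∷ p) f≤g Σg≤Σf (there v∈) =
  sumOver-tight p (f≤g ∘ there) Σg≤Σf v∈
sumOver-tight (inside ∷ p)  f≤g Σg≤Σf v∈p
  with +-tight (f≤g here) (sumOver-mono p (f≤g ∘ there)) Σg≤Σf | v∈p
... | g≤f , _ | here     = ≤-antisym (f≤g here) g≤f
... | _ , Σ≤Σ | there v∈ = sumOver-tight p (f≤g ∘ there) Σ≤Σ v∈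

sumOver-+ : (p : Subset n) (f g : Fin n → ℕ) →
  sumOver p (λ v → f v + g v) ≡ sumOver p f + sumOver p g
sumOver-+ []            f g = refl
sumOver-+ (outside ∷ p) f g = sumOver-+ p (f ∘ suc) (g ∘ suc)
sumOver-+ (inside ∷ p)  f g = trans
  (cong (f zero + g zero +_) (sumOver-+ p (f ∘ suc) (g ∘ suc)))
  (+-interchange (f zero) (g zero) _ _)
  where
  open import Algebra.Properties.CommutativeSemigroup +-commutativeSemigroup
    using () renaming (interchange to +-interchange)

sumOver-comm : (p : Subset n) (q : Subset m) (f : Fin n → Fin m → ℕ) →
  sumOver p (λ u → sumOver q (f u)) ≡ sumOver q (λ v → sumOver p (λ u → f u v))
sumOver-comm []            q f = sym (trans (sumOver-const q 0) (*-zeroʳ ∣ q ∣))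
sumOver-comm (outside ∷ p) q f = sumOver-comm p q (f ∘ suc)
sumOver-comm (inside ∷ p)  q f = trans
  (cong (sumOver q (f zero) +_) (sumOver-comm p q (f ∘ suc)))
  (sym (sumOver-+ q (f zero) _))

-- For `p = N G u` these are the entries in row `u` of the adjacency matrix.
indicator : Subset n → Fin n → ℕ
indicator p v = if lookup p v then 1 else 0

∣p∩q∣≡sumOver : (p q : Subset n) → ∣ p ∩ q ∣ ≡ sumOver q (indicator p)
∣p∩q∣≡sumOver []            []            = refl
∣p∩q∣≡sumOver (inside ∷ p)  (inside ∷ q)  = cong suc (∣p∩q∣≡sumOver p q)
∣p∩q∣≡sumOver (inside ∷ p)  (outside ∷ q) = ∣p∩q∣≡sumOver p q
∣p∩q∣≡sumOver (outside ∷ p) (inside ∷ q)  = ∣p∩q∣≡sumOver p q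
∣p∩q∣≡sumOver (outside ∷ p) (outside ∷ q) = ∣p∩q∣≡sumOver p q

-- A member of `p` outside `q` would make `p ∩ q` a proper subset of `p`, hence strictly smaller.
∣p∩q∣≡∣p∣⇒p⊆q : (p q : Subset n) → ∣ p ∩ q ∣ ≡ ∣ p ∣ → p ⊆ q
∣p∩q∣≡∣p∣⇒p⊆q p q eq {x} x∈p with x ∈? q
... | yes x∈q = x∈q
... | no  x∉q = contradiction eq (<⇒≢ (p⊂q⇒∣p∣<∣q∣
  (p∩q⊆p p q , x , x∈p , x∉q ∘ proj₂ ∘ x∈p∩q⁻ p q)))

∣p∣+∣∁p∣≡n : (p : Subset n) → ∣ p ∣ + ∣ ∁ p ∣ ≡ n
∣p∣+∣∁p∣≡n p = trans (cong (∣ p ∣ +_) (∣∁p∣≡n∸∣p∣ p)) (m+[n∸m]≡n (∣p∣≤n p))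

-- Matches `*-suc`: with `d = Δ G`, comparing `∣ p ∣ * suc d` with `n * d` amounts to comparing
-- `∣ p ∣` with `∣ ∁ p ∣ * d`.
n*d≡∣∁p∣*d+∣p∣*d : (p : Subset n) (d : ℕ) → n * d ≡ ∣ ∁ p ∣ * d + ∣ p ∣ * d
n*d≡∣∁p∣*d+∣p∣*d {n} p d = begin
  n * d                   ≡⟨ cong (_* d) (∣p∣+∣∁p∣≡n p) ⟨
  (∣ p ∣ + ∣ ∁ p ∣) * d   ≡⟨ cong (_* d) (+-comm ∣ p ∣ ∣ ∁ p ∣) ⟩
  (∣ ∁ p ∣ + ∣ p ∣) * d   ≡⟨ *-distribʳ-+ d ∣ ∁ p ∣ ∣ p ∣ ⟩
  ∣ ∁ p ∣ * d + ∣ p ∣ * d ∎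
  where open ≡-Reasoning

m%2≡1⇒1≤m : ∀ {m} → m % 2 ≡ 1 → 1 ≤ m
m%2≡1⇒1≤m {suc m} _ = s≤s z≤n

module _ (G : Graph n) where
  open Graph G

  indicator-N-sym : ∀ u v → indicator (N G u) v ≡ indicator (N G v) u
  indicator-N-sym u v = cong (if_then 1 else 0) (begin
    lookup (N G u) v ≡⟨ lookup∘tabulate _ v ⟩
    does (u ~? v)    ≡⟨ does-⇔ (mk⇔ ~-sym ~-sym) (u ~? v) (v ~? u) ⟩
    does (v ~? u)    ≡⟨ lookup∘tabulate _ u ⟨
    lookup (N G v) u ∎)
    where open ≡-Reasoning

  -- Both sides sum the `p` by `q` block of the symmetric adjacency matrix, once by rows and once by
  -- columns.
  double-counting : (p q : Subset n) →
    sumOver p (λ u → ∣ N G u ∩ q ∣) ≡ sumOver q (λ v → ∣ N G v ∩ p ∣)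
  double-counting p q = begin
    sumOver p (λ u → ∣ N G u ∩ q ∣)
      ≡⟨ sumOver-cong p (λ {u} _ → ∣p∩q∣≡sumOver (N G u) q) ⟩
    sumOver p (λ u → sumOver q (indicator (N G u)))
      ≡⟨ sumOver-comm p q _ ⟩
    sumOver q (λ v → sumOver p (λ u → indicator (N G u) v))
      ≡⟨ sumOver-cong q (λ {v} _ → trans
           (sumOver-cong p (λ {u} _ → indicator-N-sym u v))
           (sym (∣p∩q∣≡sumOver (N G v) p))) ⟩
    sumOver q (λ v → ∣ N G v ∩ p ∣) ∎
    where open ≡-Reasoning

  -- An odd count is positive; enlarging `C` to `∁ B` may change the parity but keeps the count
  -- positive.
  WOD⇒1≤∣N∩∁B∣ : ∀ {B} → WOD G B → ∀ {v} → v ∈ B → 1 ≤ ∣ N G v ∩ ∁ B ∣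
  WOD⇒1≤∣N∩∁B∣ {B} (C , C⊆∁B , B⊆Odd) {v} v∈B = ≤-trans
    (m%2≡1⇒1≤m (∈⟦⟧⁻ (λ w → ∣ N G w ∩ C ∣ % 2 ≟ 1) (B⊆Odd v∈B)))
    (p⊆q⇒∣p∣≤∣q∣ λ x∈ → let x∈N , x∈C = x∈p∩q⁻ (N G v) C x∈ in
      x∈p∩q⁺ (x∈N , C⊆∁B x∈C))

  ∣N∩B∣≤Δ : ∀ B c → ∣ N G c ∩ B ∣ ≤ Δ G
  ∣N∩B∣≤Δ B c = ≤-trans (∣p∩q∣≤∣p∣ (N G c) B) (degree≤Δ G c)

  -- The number of edges between `B` and `∁ B`, counted from their ends in `B`.
  crossing : Subset n → ℕ
  crossing B = sumOver B (λ v → ∣ N G v ∩ ∁ B ∣)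

  sum-ones : (B : Subset n) → sumOver B (λ _ → 1) ≡ ∣ B ∣
  sum-ones B = trans (sumOver-const B 1) (*-identityʳ ∣ B ∣)

  ∣B∣≤crossing : ∀ {B} → WOD G B → ∣ B ∣ ≤ crossing B
  ∣B∣≤crossing {B} w = subst (_≤ crossing B) (sum-ones B)
    (sumOver-mono B (WOD⇒1≤∣N∩∁B∣ w))

  crossing≤∣∁B∣*Δ : ∀ B → crossing B ≤ ∣ ∁ B ∣ * Δ G
  crossing≤∣∁B∣*Δ B = subst₂ _≤_
    (sym (double-counting B (∁ B))) (sumOver-const (∁ B) (Δ G))
    (sumOver-mono (∁ B) (λ {c} _ → ∣N∩B∣≤Δ B c))

  WOD⇒∣B∣*suc-Δ≤n*Δ : ∀ {B} → WOD G B → ∣ B ∣ * suc (Δ G) ≤ n * Δ G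
  WOD⇒∣B∣*suc-Δ≤n*Δ {B} w = subst₂ _≤_
    (sym (*-suc ∣ B ∣ (Δ G))) (sym (n*d≡∣∁p∣*d+∣p∣*d B (Δ G)))
    (+-monoˡ-≤ (∣ B ∣ * Δ G) (≤-trans (∣B∣≤crossing w) (crossing≤∣∁B∣*Δ B)))

  extremal-WOD⇒perfect-code : ∀ {B} → WOD G B → ∣ B ∣ * suc (Δ G) ≡ n * Δ G →
    PerfectCode G (∁ B) × (∀ v → v ∈ ∁ B → degree G v ≡ Δ G)
  extremal-WOD⇒perfect-code {B} w eq =
    (independent , λ v∉∁B → sym (one-neighbour (x∉∁p⇒x∈p v∉∁B))) ,
    λ v v∈ → ≤-antisym (degree≤Δ G v)
      (subst (_≤ degree G v) (Δ-neighbours v∈) (∣p∩q∣≤∣p∣ (N G v) B))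
    where
    -- This makes the two ends of `∣ B ∣ ≤ crossing B ≤ ∣ ∁ B ∣ * Δ G` equal, so both bounds are
    -- tight at every vertex.
    ∣B∣≡∣∁B∣*Δ : ∣ B ∣ ≡ ∣ ∁ B ∣ * Δ G
    ∣B∣≡∣∁B∣*Δ = +-cancelʳ-≡ (∣ B ∣ * Δ G) _ _
      (trans (sym (*-suc ∣ B ∣ (Δ G))) (trans eq (n*d≡∣∁p∣*d+∣p∣*d B (Δ G))))

    one-neighbour : ∀ {v} → v ∈ B → 1 ≡ ∣ N G v ∩ ∁ B ∣
    one-neighbour = sumOver-tight B (WOD⇒1≤∣N∩∁B∣ w)
      (subst (crossing B ≤_) (trans (sym ∣B∣≡∣∁B∣*Δ) (sym (sum-ones B)))
        (crossing≤∣∁B∣*Δ B))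

    Δ-neighbours : ∀ {c} → c ∈ ∁ B → ∣ N G c ∩ B ∣ ≡ Δ G
    Δ-neighbours = sumOver-tight (∁ B) (λ {c} _ → ∣N∩B∣≤Δ B c)
      (subst₂ _≤_ (trans ∣B∣≡∣∁B∣*Δ (sym (sumOver-const (∁ B) (Δ G))))
        (double-counting B (∁ B)) (∣B∣≤crossing w))

    -- `N G u` has at most `Δ G` elements and `Δ G` of them lie in `B`, so no neighbour of `u` is
    -- left for `∁ B`.
    independent : Independent G (∁ B)
    independent {u} u∈ v∈ u~v = x∈∁p⇒x∉p v∈
      (∣p∩q∣≡∣p∣⇒p⊆q (N G u) B
        (≤-antisym (∣p∩q∣≤∣p∣ (N G u) B)
          (subst (degree G u ≤_) (sym (Δ-neighbours u∈)) (degree≤Δ G u)))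
        (∈⟦⟧⁺ (u ~?_) u~v))

  -- `C` itself is the dominating set: each vertex outside has exactly one neighbour in it, and 1 is
  -- odd.
  perfect-code⇒∁-WOD : ∀ {C} → PerfectCode G C → WOD G (∁ C)
  perfect-code⇒∁-WOD {C} (_ , one) = C ,
    (λ x∈C → x∉p⇒x∈∁p (x∈p⇒x∉∁p x∈C)) ,
    λ x∈∁C → ∈⟦⟧⁺ (λ w → ∣ N G w ∩ C ∣ % 2 ≟ 1)
      (cong (_% 2) (one (x∈∁p⇒x∉p x∈∁C)))

  perfect-code⇒∣∁C∣*suc-Δ≡n*Δ : ∀ {C} → PerfectCode G C →
    (∀ v → v ∈ C → degree G v ≡ Δ G) → ∣ ∁ C ∣ * suc (Δ G) ≡ n * Δ G
  perfect-code⇒∣∁C∣*suc-Δ≡n*Δ {C} (indep , one) deg = begin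
    ∣ ∁ C ∣ * suc (Δ G)             ≡⟨ *-suc ∣ ∁ C ∣ (Δ G) ⟩
    ∣ ∁ C ∣ + ∣ ∁ C ∣ * Δ G         ≡⟨ cong (_+ ∣ ∁ C ∣ * Δ G) ∣∁C∣≡∣C∣*Δ ⟩
    ∣ C ∣ * Δ G + ∣ ∁ C ∣ * Δ G     ≡⟨ +-comm (∣ C ∣ * Δ G) _ ⟩
    ∣ ∁ C ∣ * Δ G + ∣ C ∣ * Δ G     ≡⟨ n*d≡∣∁p∣*d+∣p∣*d C (Δ G) ⟨
    n * Δ G                         ∎
    where
    open ≡-Reasoning

    -- By independence every neighbour of `c` lies in `∁ C`, so the count is the full degree.
    ∣N∩∁C∣≡Δ : ∀ {c} → c ∈ C → ∣ N G c ∩ ∁ C ∣ ≡ Δ G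
    ∣N∩∁C∣≡Δ {c} c∈C = trans
      (≤-antisym (∣p∩q∣≤∣p∣ (N G c) (∁ C)) (p⊆q⇒∣p∣≤∣q∣ λ x∈N →
        x∈p∩q⁺ (x∈N , x∉p⇒x∈∁p λ x∈C → indep c∈C x∈C (∈⟦⟧⁻ (c ~?_) x∈N))))
      (deg c c∈C)

    ∣∁C∣≡∣C∣*Δ : ∣ ∁ C ∣ ≡ ∣ C ∣ * Δ G
    ∣∁C∣≡∣C∣*Δ = begin
      ∣ ∁ C ∣                              ≡⟨ sum-ones (∁ C) ⟨
      sumOver (∁ C) (λ _ → 1)              ≡⟨ sumOver-cong (∁ C) (sym ∘ one ∘ x∈∁p⇒x∉p) ⟩
      sumOver (∁ C) (λ v → ∣ N G v ∩ C ∣)  ≡⟨ double-counting (∁ C) C ⟩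
      sumOver C (λ c → ∣ N G c ∩ ∁ C ∣)    ≡⟨ sumOver-cong C ∣N∩∁C∣≡Δ ⟩
      sumOver C (λ _ → Δ G)                ≡⟨ sumOver-const C (Δ G) ⟩
      ∣ C ∣ * Δ G                          ∎

  κ*suc-Δ≡n*Δ⇒perfect-code : κ G * suc (Δ G) ≡ n * Δ G →
    ∃ λ C → PerfectCode G C × (∀ v → v ∈ C → degree G v ≡ Δ G)
  κ*suc-Δ≡n*Δ⇒perfect-code eq with κ-attained G
  ... | B , w , ∣B∣≡κ = ∁ B ,
    extremal-WOD⇒perfect-code w (trans (cong (_* suc (Δ G)) ∣B∣≡κ) eq)

  -- The upper bound applies the general inequality to a maximum WOD set; the lower bound comes from
  -- the WOD set `∁ C`.
  perfect-code⇒κ*suc-Δ≡n*Δ :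
    (∃ λ C → PerfectCode G C × (∀ v → v ∈ C → degree G v ≡ Δ G)) →
    κ G * suc (Δ G) ≡ n * Δ G
  perfect-code⇒κ*suc-Δ≡n*Δ (C , code , deg) with κ-attained G
  ... | B , w , ∣B∣≡κ = ≤-antisym
    (subst (λ k → k * suc (Δ G) ≤ n * Δ G) ∣B∣≡κ (WOD⇒∣B∣*suc-Δ≤n*Δ w))
    (subst (_≤ κ G * suc (Δ G)) (perfect-code⇒∣∁C∣*suc-Δ≡n*Δ code deg)
      (*-monoˡ-≤ (suc (Δ G)) (WOD⇒≤κ G (perfect-code⇒∁-WOD code))))

-- Opened only here, since +_ makes the sections (k +_) above ambiguous.
open import Data.Integer.Base using (+_)

-- `_/_` reduces to lowest terms, so the equality is moved to unnormalised rationals, where it is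
-- cross-multiplication.
/1≡/⇔ : ∀ k a d → (+ k) / 1 ≡ (+ a) / suc d ⇔ k * suc d ≡ a
/1≡/⇔ k a d = mk⇔ to from
  where
  to : (+ k) / 1 ≡ (+ a) / suc d → k * suc d ≡ a
  -- `mkℚᵘ` stores the denominator minus one: `0` stands for 1 and `d` for `suc d`.
  to eq with fromℚᵘ-injective {mkℚᵘ (+ k) 0} {mkℚᵘ (+ a) d} eq
  ... | *≡* eqᵘ = +-injective (trans (pos-* k (suc d)) (trans eqᵘ
    (trans (sym (pos-* a 1)) (cong +_ (*-identityʳ a)))))

  from : k * suc d ≡ a → (+ k) / 1 ≡ (+ a) / suc d
  from eq = fromℚᵘ-cong {mkℚᵘ (+ k) 0} {mkℚᵘ (+ a) d} (*≡*
    (trans (sym (pos-* k (suc d))) (trans (cong +_ eq)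
      (trans (cong +_ (sym (*-identityʳ a))) (pos-* a 1)))))

theorem2 : (n : ℕ) → n ≥ 1 → (G : Graph n) →
    (+ κ G) / 1 ≡ (+ (n * Δ G)) / suc (Δ G)
    ⇔ (∃ λ (C : Subset n) → PerfectCode G C × (∀ v → v ∈ C → degree G v ≡ Δ G))
theorem2 n _ G = mk⇔ (κ*suc-Δ≡n*Δ⇒perfect-code G) (perfect-code⇒κ*suc-Δ≡n*Δ G)
  ⇔-∘ /1≡/⇔ (κ G) (n * Δ G) (Δ G)
  where open import Function.Construct.Composition using (_⇔-∘_)
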